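{- Let $\mathbb H=(A,\prec,\mathcal C)$ be a defined proto sp-algebra with $A$ a bounded lattice, and let $\overline{\mathcal C}=(A\times A)\setminus\mathcal C$. Let $\rhd a=\bigvee\{b\in A\mid a\,\overline{\mathcal C}\,b\}$ in $A^\delta$. For $1\le i\le4$ let $\prec_i$, $\overline{\mathcal C}_i$ be the closures of $\prec$, $\overline{\mathcal C}$ defined in the context, and let $\Diamond_ia=\bigwedge\{b\in A\mid a\prec_ib\}$ and $\rhd_ia=\bigvee\{b\in A\mid a\,\overline{\mathcal C}_i\,b\}$ in $A^\delta$. Among maps $g:A\to A^\delta$ with $g(a)\in O(A^\delta)$ for all $a\in A$, ordered pointwise: 1. $\rhd_1$ is the smallest antitone map dominating $\rhd$. 2. $\rhd_2$ is the smallest regular map dominating $\rhd$. 3. $\rhd_3$ is the smallest antitone map $g$ dominating $\rhd$ which satisfies $g(a\wedge\Diamond_3a)\le g(a)$ for all $a\in A$. 4. $\rhd_4$ is the smallest regular map $g$ dominating $\rhd$ which satisfies $g(a\wedge\Diamond_4a)\le g(a)$ for all $a\in A$. (In each item it is part of the claim that $\rhd_i$ itself is a map of the stated kind.)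
   Context: Canonical extension. For a poset $A$, $A^\delta$ is a complete lattice containing $A$ as a subposet. $k\in A^\delta$ is closed ($k\in K(A^\delta)$) if $k=\bigwedge F$ for some nonempty down-directed $F\subseteq A$; $o$ is open ($o\in O(A^\delta)$) if $o=\bigvee I$ for some nonempty up-directed $I\subseteq A$. Denseness: every element of $A^\delta$ is a join of closed elements and a meet of open elements. Compactness: if $F\subseteq A$ is nonempty down-directed, $I\subseteq A$ nonempty up-directed and $\bigwedge F\le\bigvee I$, then $a\le b$ for some $a\in F$, $b\in I$. $A^\delta$ exists and is unique up to isomorphism fixing $A$. A proto sp-algebra is $(A,\prec,\mathcal C)$ with $\prec,\mathcal C\subseteq A\times A$. It is defined if for $\prec$: $\forall a\exists b(b\prec a)$; $\forall a\exists b(a\prec b)$; $a\prec x_1\ \&\ a\prec x_2\Rightarrow\exists x(a\prec x\ \&\ x\le x_1\ \&\ x\le x_2)$; $a_1\prec x\ \&\ a_2\prec x\Rightarrow\exists a(a\prec x\ \&\ a_1\le a\ \&\ a_2\le a)$; and for $\overline{\mathcal C}$: $\forall a\exists b(b\,\overline{\mathcal C}\,a)$; $\forall a\exists b(a\,\overline{\mathcal C}\,b)$; $a\,\overline{\mathcal C}\,x_1\ \&\ a\,\overline{\mathcal C}\,x_2\Rightarrow\exists x(x_1\le x\ \&\ x_2\le x\ \&\ a\,\overline{\mathcal C}\,x)$; $a_1\,\overline{\mathcal C}\,x\ \&\ a_2\,\overline{\mathcal C}\,x\Rightarrow\exists a(a_1\le a\ \&\ a_2\le a\ \&\ a\,\overline{\mathcal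 C}\,x)$. $\prec_i$ is the smallest extension of $\prec$ satisfying: ($\top$) $\top\prec\top$, (SI) $a\le b\prec x\Rightarrow a\prec x$, (WO) $b\prec x\le y\Rightarrow b\prec y$, (AND) $a\prec x\ \&\ a\prec y\Rightarrow a\prec x\wedge y$; together with, for $i\in\{2,4\}$, (OR) $a\prec x\ \&\ b\prec x\Rightarrow a\vee b\prec x$; and, for $i\in\{3,4\}$, (CT) $a\prec b\ \&\ a\wedge b\prec c\Rightarrow a\prec c$. $\overline{\mathcal C}_i$ is the smallest extension $N$ of $\overline{\mathcal C}$ satisfying: $\top\,N\,\bot$; $b\,N\,c\ \&\ a\le b\Rightarrow a\,N\,c$; $a\,N\,c\ \&\ b\le c\Rightarrow a\,N\,b$; $a\,N\,b\ \&\ a\,N\,c\Rightarrow a\,N\,(b\vee c)$; together with, for $i\in\{2,4\}$, $a\,N\,c\ \&\ b\,N\,c\Rightarrow(a\vee b)\,N\,c$; and, for $i\in\{3,4\}$, $a\prec_ib\ \&\ (a\wedge b)\,N\,c\Rightarrow a\,N\,c$. $g$ dominates $\rhd$ if $\rhd a\le g(a)$ for all $a\in A$; $g$ is antitone if $a\le b$ implies $g(b)\le g(a)$; regular if $g(a\vee b)=g(a)\wedge g(b)$ for all $a,b\in A$. In $g(a\wedge\Diamond_ia)$, $g$ is evaluated at the closed element $a\wedge\Diamond_ia$ by $g(k):=\bigvee\{g(c)\mid c\in A,k\le c\}$. -}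

module Defs where

open import Level using (Level; _⊔_; suc)
open import Data.Product.Base using (Σ; Σ-syntax; ∃; ∃-syntax; _×_; _,_; proj₁)
open import Relation.Nullary.Negation.Core using (¬_)
open import Relation.Unary using (Pred)
open import Relation.Binary.Core using (Rel; _Preserves_⟶_)
open import Relation.Binary.Definitions using (_Respects₂_; Antitonic₁)
open import Relation.Binary.Bundles using (Poset)
open import Relation.Binary.Lattice.Bundles using (Lattice; BoundedLattice)
open import Relation.Binary.Morphism.Structures using (IsOrderMonomorphism)

-- Joins and meets are taken over families indexed by types in Set ℓ.  The
-- order is valued in Set ℓ too, so that { c ∈ A ∣ k ≤ c } is such a family;
-- the carrier and the equality may live in larger universes.
record CompleteLattice d e ℓ : Set (suc (d ⊔ e ⊔ ℓ)) where
  field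
    lattice : Lattice d e ℓ

  open Lattice lattice public

  field
    ⋁ : {I : Set ℓ} → (I → Carrier) → Carrier
    ⋀ : {I : Set ℓ} → (I → Carrier) → Carrier

    ⋁-upper    : ∀ {I : Set ℓ} (f : I → Carrier) (i : I) → f i ≤ ⋁ f
    ⋁-least    : ∀ {I : Set ℓ} (f : I → Carrier) (u : Carrier) →
                 (∀ i → f i ≤ u) → ⋁ f ≤ u
    ⋀-lower    : ∀ {I : Set ℓ} (f : I → Carrier) (i : I) → ⋀ f ≤ f i
    ⋀-greatest : ∀ {I : Set ℓ} (f : I → Carrier) (u : Carrier) →
                 (∀ i → u ≤ f i) → u ≤ ⋀ f

module _ {ℓ} (A : Poset ℓ ℓ ℓ) where
  open Poset A

  UpDirected : Pred Carrier ℓ → Set ℓ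
  UpDirected I = ∀ {x y} → I x → I y → ∃[ z ] (I z × x ≤ z × y ≤ z)

  DownDirected : Pred Carrier ℓ → Set ℓ
  DownDirected F = ∀ {x y} → F x → F y → ∃[ z ] (F z × z ≤ x × z ≤ y)

  -- Predicates on A are not required to respect _≈_; passing to the
  -- ≈-saturation changes neither joins, meets nor directedness.
  record CanonicalExtension d e : Set (suc (d ⊔ e ⊔ ℓ)) where
    field
      completeLattice : CompleteLattice d e ℓ

    module L = CompleteLattice completeLattice

    field
      η           : Carrier → L.Carrier
      η-embedding : IsOrderMonomorphism _≈_ L._≈_ _≤_ L._≤_ η

    ⋁[_] : Pred Carrier ℓ → L.Carrier
    ⋁[ I ] = L.⋁ {I = Σ Carrier I} (λ p → η (proj₁ p))

    ⋀[_] : Pred Carrier ℓ → L.Carrier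
    ⋀[ F ] = L.⋀ {I = Σ Carrier F} (λ p → η (proj₁ p))

    IsClosed : L.Carrier → Set (e ⊔ suc ℓ)
    IsClosed k = ∃[ F ] (∃ F × DownDirected F × k L.≈ ⋀[ F ])

    IsOpen : L.Carrier → Set (e ⊔ suc ℓ)
    IsOpen o = ∃[ I ] (∃ I × UpDirected I × o L.≈ ⋁[ I ])

    field
      dense-closed : ∀ u → Σ[ J ∈ Set ℓ ] Σ[ k ∈ (J → L.Carrier) ]
                     ((∀ j → IsClosed (k j)) × u L.≈ L.⋁ k)
      dense-open   : ∀ u → Σ[ J ∈ Set ℓ ] Σ[ o ∈ (J → L.Carrier) ]
                     ((∀ j → IsOpen (o j)) × u L.≈ L.⋀ o)
      compact      : ∀ (F I : Pred Carrier ℓ) →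
                     ∃ F → DownDirected F → ∃ I → UpDirected I →
                     ⋀[ F ] L.≤ ⋁[ I ] →
                     ∃[ a ] ∃[ b ] (F a × I b × a ≤ b)

  record ProtoSpAlgebra : Set (suc ℓ) where
    infix 4 _≺_ _𝒞_ _𝒞̄_
    field
      _≺_ : Rel Carrier ℓ
      _𝒞_ : Rel Carrier ℓ
      -- ≺ and 𝒞 are relations on the setoid A
      ≺-resp-≈ : _≺_ Respects₂ _≈_
      𝒞-resp-≈ : _𝒞_ Respects₂ _≈_

    _𝒞̄_ : Rel Carrier ℓ
    a 𝒞̄ b = ¬ (a 𝒞 b)

  record IsDefined (H : ProtoSpAlgebra) : Set ℓ where
    open ProtoSpAlgebra H
    field
      ≺-serialˡ   : ∀ a → ∃[ b ] (b ≺ a)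
      ≺-serialʳ   : ∀ a → ∃[ b ] (a ≺ b)
      ≺-directedʳ : ∀ {a x₁ x₂} → a ≺ x₁ → a ≺ x₂ →
                    ∃[ x ] (a ≺ x × x ≤ x₁ × x ≤ x₂)
      ≺-directedˡ : ∀ {a₁ a₂ x} → a₁ ≺ x → a₂ ≺ x →
                    ∃[ a ] (a ≺ x × a₁ ≤ a × a₂ ≤ a)
      𝒞̄-serialˡ   : ∀ a → ∃[ b ] (b 𝒞̄ a)
      𝒞̄-serialʳ   : ∀ a → ∃[ b ] (a 𝒞̄ b)
      𝒞̄-directedʳ : ∀ {a x₁ x₂} → a 𝒞̄ x₁ → a 𝒞̄ x₂ →
                    ∃[ x ] (x₁ ≤ x × x₂ ≤ x × a 𝒞̄ x)
      𝒞̄-directedˡ : ∀ {a₁ a₂ x} → a₁ 𝒞̄ x → a₂ 𝒞̄ x →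
                    ∃[ a ] (a₁ ≤ a × a₂ ≤ a × a 𝒞̄ x)

data Index : Set where
  #1 #2 #3 #4 : Index

data HasOR : Index → Set where
  or₂ : HasOR #2
  or₄ : HasOR #4

data HasCT : Index → Set where
  ct₃ : HasCT #3
  ct₄ : HasCT #4

module _ {ℓ} (A : BoundedLattice ℓ ℓ ℓ) where
  open BoundedLattice A

  -- The smallest relation containing R and closed under the rules of index i.
  data Closure≺ (R : Rel Carrier ℓ) (i : Index) : Rel Carrier ℓ where
    base : ∀ {a b} → R a b → Closure≺ R i a b
    top  : Closure≺ R i ⊤ ⊤
    si   : ∀ {a b x} → a ≤ b → Closure≺ R i b x → Closure≺ R i a x
    wo   : ∀ {b x y} → Closure≺ R i b x → x ≤ y → Closure≺ R i b y
    and  : ∀ {a x y} → Closure≺ R i a x → Closure≺ R i a y →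
           Closure≺ R i a (x ∧ y)
    or   : HasOR i → ∀ {a b x} → Closure≺ R i a x → Closure≺ R i b x →
           Closure≺ R i (a ∨ b) x
    ct   : HasCT i → ∀ {a b c} → Closure≺ R i a b → Closure≺ R i (a ∧ b) c →
           Closure≺ R i a c

  -- Likewise for the smallest extension of N; ct refers to the closure of R.
  data Closure𝒞̄ (R N : Rel Carrier ℓ) (i : Index) : Rel Carrier ℓ where
    base : ∀ {a b} → N a b → Closure𝒞̄ R N i a b
    top  : Closure𝒞̄ R N i ⊤ ⊥
    si   : ∀ {a b c} → Closure𝒞̄ R N i b c → a ≤ b → Closure𝒞̄ R N i a c
    wo   : ∀ {a b c} → Closure𝒞̄ R N i a c → b ≤ c → Closure𝒞̄ R N i a b
    and  : ∀ {a b c} → Closure𝒞̄ R N i a b → Closure𝒞̄ R N i a c →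
           Closure𝒞̄ R N i a (b ∨ c)
    or   : HasOR i → ∀ {a b c} → Closure𝒞̄ R N i a c → Closure𝒞̄ R N i b c →
           Closure𝒞̄ R N i (a ∨ b) c
    ct   : HasCT i → ∀ {a b c} → Closure≺ R i a b → Closure𝒞̄ R N i (a ∧ b) c →
           Closure𝒞̄ R N i a c

module Operators {ℓ d e} (A : BoundedLattice ℓ ℓ ℓ)
                 (H : ProtoSpAlgebra (BoundedLattice.poset A))
                 (Aδ : CanonicalExtension (BoundedLattice.poset A) d e) where
  open BoundedLattice A
  open ProtoSpAlgebra H
  open CanonicalExtension Aδ

  ≺[_] : Index → Rel Carrier ℓ
  ≺[ i ] = Closure≺ A _≺_ i

  𝒞̄[_] : Index → Rel Carrier ℓ
  𝒞̄[ i ] = Closure𝒞̄ A _≺_ _𝒞̄_ i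

  ▷ : Carrier → L.Carrier
  ▷ a = ⋁[ (λ b → a 𝒞̄ b) ]

  ◇[_] : Index → Carrier → L.Carrier
  ◇[ i ] a = ⋀[ (λ b → ≺[ i ] a b) ]

  ▷[_] : Index → Carrier → L.Carrier
  ▷[ i ] a = ⋁[ (λ b → 𝒞̄[ i ] a b) ]

  -- A map A → A^δ in the sense of setoids, with open values.
  IsOpenMap : (Carrier → L.Carrier) → Set (e ⊔ suc ℓ)
  IsOpenMap g = g Preserves _≈_ ⟶ L._≈_ × (∀ a → IsOpen (g a))

  Antitone : (Carrier → L.Carrier) → Set ℓ
  Antitone = Antitonic₁ _≤_ L._≤_

  Regular : (Carrier → L.Carrier) → Set (ℓ ⊔ e)
  Regular g = ∀ a b → g (a ∨ b) L.≈ (g a L.∧ g b)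

  _Dominates_ : (g f : Carrier → L.Carrier) → Set ℓ
  g Dominates f = ∀ a → f a L.≤ g a

  -- The value of g at a closed element k of A^δ.
  extend : (Carrier → L.Carrier) → L.Carrier → L.Carrier
  extend g k = L.⋁ {I = Σ[ c ∈ Carrier ] (k L.≤ η c)} (λ p → g (proj₁ p))

  CumTrans[_] : Index → (Carrier → L.Carrier) → Set ℓ
  CumTrans[ i ] g = ∀ a → extend g (η a L.∧ ◇[ i ] a) L.≤ g a

  IsSmallest : ∀ {p} → ((Carrier → L.Carrier) → Set p) →
               (Carrier → L.Carrier) → Set (ℓ ⊔ d ⊔ p)
  IsSmallest P g = P g × (∀ h → P h → ∀ a → g a L.≤ h a)

-- Leastness is an induction on the closure rules, whose claim is that a 𝒞̄ᵢ b
-- implies η b ≤ g a: openness of g a handles (top) and (and), since an element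
-- of A below a directed join lies below one of its members.  Conversely, the
-- extra properties of ▷ᵢ follow from compactness: a closed element below ▷ᵢ a
-- lies below some b with a 𝒞̄ᵢ b, and if η a ∧ ◇ᵢ a ≤ η c then a ∧ x ≤ c for
-- some x with a ≺ᵢ x, so that (ct) applies.

{-# OPTIONS --safe #-}
module Submission where

open import Data.Product.Base using (_×_; _,_; proj₂; ∃; ∃-syntax)
open import Relation.Unary using (Pred)
open import Relation.Binary.Lattice.Bundles using (Lattice; BoundedLattice)
open import Relation.Binary.Morphism.Structures using (IsOrderMonomorphism)
import Relation.Binary.Lattice.Properties.JoinSemilattice as JoinSemilattice
import Relation.Binary.Lattice.Properties.MeetSemilattice as MeetSemilattice
open import Defs

module CanonicalExtensionProperties {ℓ d e} (A : Lattice ℓ ℓ ℓ)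
    (Aδ : CanonicalExtension (Lattice.poset A) d e) where
  open Lattice A
  open CanonicalExtension Aδ
  open IsOrderMonomorphism η-embedding using (mono)

  ⋁[]-upper : ∀ (I : Pred Carrier ℓ) {b} → I b → η b L.≤ ⋁[ I ]
  ⋁[]-upper I {b} b∈I = L.⋁-upper _ (b , b∈I)

  ⋀[]-lower : ∀ (F : Pred Carrier ℓ) {a} → F a → ⋀[ F ] L.≤ η a
  ⋀[]-lower F {a} a∈F = L.⋀-lower _ (a , a∈F)

  -- Compactness against the principal ideal of `a`, which is directed and has `η a` as its join.
  ⋀[]≤η⇒∃ : ∀ {F a} → ∃ F → DownDirected poset F → ⋀[ F ] L.≤ η a →
            ∃[ f ] (F f × f ≤ a)
  ⋀[]≤η⇒∃ {F} {a} F≠∅ F-dir ⋀F≤ηa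
    with f , b , f∈F , b≤a , f≤b ←
      compact F (_≤ a) F≠∅ F-dir (a , refl) (λ p q → a , refl , p , q)
        (L.trans ⋀F≤ηa (⋁[]-upper (_≤ a) refl))
    = f , f∈F , trans f≤b b≤a

  -- Dually, compactness with the principal filter of `a`.
  η≤⋁[]⇒∃ : ∀ {I a} → ∃ I → UpDirected poset I → η a L.≤ ⋁[ I ] →
            ∃[ b ] (I b × a ≤ b)
  η≤⋁[]⇒∃ {I} {a} I≠∅ I-dir ηa≤⋁I
    with f , b , a≤f , b∈I , f≤b ←
      compact (a ≤_) I (a , refl) (λ p q → a , refl , p , q) I≠∅ I-dir
        (L.trans (⋀[]-lower (a ≤_) refl) ηa≤⋁I)
    = b , b∈I , trans a≤f f≤b

  -- Denseness reduces an inequality to closed elements, where compactness can be used.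
  dense-closed-≤ : ∀ {u v} → (∀ k → IsClosed k → k L.≤ u → k L.≤ v) → u L.≤ v
  dense-closed-≤ {u} {v} below with J , k , k-closed , u≈⋁k ← dense-closed u =
    L.trans (L.reflexive u≈⋁k) (L.⋁-least k v λ j →
      below (k j) (k-closed j)
        (L.trans (L.⋁-upper k j) (L.reflexive (L.Eq.sym u≈⋁k))))

  -- `η` is given only as an order embedding, so its preservation of binary meets is derived: if
  -- `⋀[ F ]` is below `η a` and `η b`, directedness yields one member of `F` below both `a` and
  -- `b`.
  η-∧-greatest : ∀ {u a b} → u L.≤ η a → u L.≤ η b → u L.≤ η (a ∧ b)
  η-∧-greatest {u} {a} {b} u≤ηa u≤ηb = dense-closed-≤ closed
    where
    closed : ∀ k → IsClosed k → k L.≤ u → k L.≤ η (a ∧ b)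
    closed k (F , F≠∅ , F-dir , k≈⋀F) k≤u
      with ⋀F≤u ← L.trans (L.reflexive (L.Eq.sym k≈⋀F)) k≤u
      with f₁ , f₁∈F , f₁≤a ← ⋀[]≤η⇒∃ F≠∅ F-dir (L.trans ⋀F≤u u≤ηa)
         | f₂ , f₂∈F , f₂≤b ← ⋀[]≤η⇒∃ F≠∅ F-dir (L.trans ⋀F≤u u≤ηb)
      with f , f∈F , f≤f₁ , f≤f₂ ← F-dir f₁∈F f₂∈F
      = L.trans (L.reflexive k≈⋀F) (L.trans (⋀[]-lower F f∈F)
          (mono (∧-greatest (trans f≤f₁ f₁≤a) (trans f≤f₂ f₂≤b))))

  open-∨-least : ∀ {o a b} → IsOpen o → η a L.≤ o → η b L.≤ o →
                 η (a ∨ b) L.≤ o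
  open-∨-least (I , I≠∅ , I-dir , o≈⋁I) ηa≤o ηb≤o
    with x , x∈I , a≤x ← η≤⋁[]⇒∃ I≠∅ I-dir (L.trans ηa≤o (L.reflexive o≈⋁I))
       | y , y∈I , b≤y ← η≤⋁[]⇒∃ I≠∅ I-dir (L.trans ηb≤o (L.reflexive o≈⋁I))
    with z , z∈I , x≤z , y≤z ← I-dir x∈I y∈I
    = L.trans (mono (∨-least (trans a≤x x≤z) (trans b≤y y≤z)))
        (L.trans (⋁[]-upper I z∈I) (L.reflexive (L.Eq.sym o≈⋁I)))

module ClosureProperties {ℓ d e} (A : BoundedLattice ℓ ℓ ℓ)
    (H : ProtoSpAlgebra (BoundedLattice.poset A))
    (defined : IsDefined (BoundedLattice.poset A) H)
    (Aδ : CanonicalExtension (BoundedLattice.poset A) d e) where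
  open BoundedLattice A
  open ProtoSpAlgebra H
  open IsDefined defined
  open CanonicalExtension Aδ
  open IsOrderMonomorphism η-embedding using (mono)
  open Operators A H Aδ
  open CanonicalExtensionProperties lattice Aδ

  𝒞̄-nonempty : ∀ i a → ∃ (𝒞̄[ i ] a)
  𝒞̄-nonempty i a with b , a𝒞̄b ← 𝒞̄-serialʳ a = b , base a𝒞̄b

  𝒞̄-upDirected : ∀ i a → UpDirected poset (𝒞̄[ i ] a)
  𝒞̄-upDirected i a {x} {y} p q = x ∨ y , and p q , x≤x∨y x y , y≤x∨y x y

  ▷-antitone : ∀ i → Antitone ▷[ i ]
  ▷-antitone i {b} a≤b = L.⋁-least _ _ λ (c , bNc) →
    ⋁[]-upper (𝒞̄[ i ] _) (si bNc a≤b)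

  ▷-isOpenMap : ∀ i → IsOpenMap ▷[ i ]
  ▷-isOpenMap i =
    (λ a≈b → L.antisym (▷-antitone i (reflexive (Eq.sym a≈b)))
                       (▷-antitone i (reflexive a≈b))) ,
    (λ a → 𝒞̄[ i ] a , 𝒞̄-nonempty i a , 𝒞̄-upDirected i a , L.Eq.refl)

  ▷-dominates : ∀ i → ▷[ i ] Dominates ▷
  ▷-dominates i a = L.⋁-least _ _ λ (b , a𝒞̄b) →
    ⋁[]-upper (𝒞̄[ i ] a) (base a𝒞̄b)

  -- Antitonicity gives one inequality. The other is tested on closed elements, because a meet of
  -- two joins need not distribute in the extension.
  ▷-regular : ∀ {i} → HasOR i → Regular ▷[ i ]
  ▷-regular {i} hasOR a b = L.antisym
    (L.∧-greatest (▷-antitone i (x≤x∨y a b)) (▷-antitone i (y≤x∨y a b)))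
    (dense-closed-≤ closed)
    where
    closed : ∀ k → IsClosed k → k L.≤ ▷[ i ] a L.∧ ▷[ i ] b →
             k L.≤ ▷[ i ] (a ∨ b)
    closed k (F , F≠∅ , F-dir , k≈⋀F) k≤
      with ⋀F≤ ← L.trans (L.reflexive (L.Eq.sym k≈⋀F)) k≤
      with f₁ , x , f₁∈F , aNx , f₁≤x ←
             compact F (𝒞̄[ i ] a) F≠∅ F-dir (𝒞̄-nonempty i a) (𝒞̄-upDirected i a)
               (L.trans ⋀F≤ (L.x∧y≤x _ _))
         | f₂ , y , f₂∈F , bNy , f₂≤y ←
             compact F (𝒞̄[ i ] b) F≠∅ F-dir (𝒞̄-nonempty i b) (𝒞̄-upDirected i b)
               (L.trans ⋀F≤ (L.x∧y≤y _ _))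
      with f , f∈F , f≤f₁ , f≤f₂ ← F-dir f₁∈F f₂∈F
      -- As `f` lies below both `x` and `y`, `wo` relates `a` and `b` to the same element, as `or`
      -- requires.
      = L.trans (L.reflexive k≈⋀F) (L.trans (⋀[]-lower F f∈F)
          (⋁[]-upper (𝒞̄[ i ] (a ∨ b))
            (or hasOR (wo aNx (trans f≤f₁ f₁≤x)) (wo bNy (trans f≤f₂ f₂≤y)))))

  ∧◇≤η⇒∃ : ∀ i {a c} → η a L.∧ ◇[ i ] a L.≤ η c → ∃[ x ] (≺[ i ] a x × a ∧ x ≤ c)
  ∧◇≤η⇒∃ i {a} {c} ηa∧◇a≤ηc =
    let b , a≺b = ≺-serialʳ a
        F∋a∧b = b , base a≺b , refl
        y , (x , a≺x , a∧x≤y) , y≤c =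
          ⋀[]≤η⇒∃ (a ∧ b , F∋a∧b) F-dir
            -- `⋀[ F ]` lies below `η a ∧ ◇ᵢ a`: `F` contains `a ∧ b` and every `z` with `a ≺ᵢ z`.
            (L.trans (L.∧-greatest
              (L.trans (⋀[]-lower F F∋a∧b) (mono (x∧y≤x a b)))
              (L.⋀-greatest _ _ λ (z , a≺z) → ⋀[]-lower F (z , a≺z , x∧y≤y a z)))
            ηa∧◇a≤ηc)
    in x , a≺x , trans a∧x≤y y≤c
    where
    open MeetSemilattice meetSemilattice using (∧-monotonic)

    -- The filter generated by the elements `a ∧ x` with `a ≺ᵢ x`; upward closure puts each such `x`
    -- itself in `F`.
    F : Pred Carrier ℓ
    F y = ∃[ x ] (≺[ i ] a x × a ∧ x ≤ y)

    F-dir : DownDirected poset F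
    F-dir (x₁ , a≺x₁ , ax₁≤y₁) (x₂ , a≺x₂ , ax₂≤y₂) =
      a ∧ (x₁ ∧ x₂) , (x₁ ∧ x₂ , and a≺x₁ a≺x₂ , refl) ,
      trans (∧-monotonic refl (x∧y≤x x₁ x₂)) ax₁≤y₁ ,
      trans (∧-monotonic refl (x∧y≤y x₁ x₂)) ax₂≤y₂

  ▷-cumTrans : ∀ {i} → HasCT i → CumTrans[ i ] ▷[ i ]
  ▷-cumTrans {i} hasCT a =
    L.⋁-least _ _ λ (c , k≤ηc) →
    L.⋁-least _ _ λ (b , cNb) →
    let x , a≺x , a∧x≤c = ∧◇≤η⇒∃ i k≤ηc in
    ⋁[]-upper (𝒞̄[ i ] a) (ct hasCT a≺x (si cNb a∧x≤c))

  -- Lets the regular cases use the leastness argument for antitone maps.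
  regular⇒antitone : ∀ {g} → IsOpenMap g → Regular g → Antitone g
  regular⇒antitone (g-cong , _) g-reg {y} {x} x≤y =
    L.trans (L.reflexive (L.Eq.trans (g-cong (Eq.sym (x≤y⇒x∨y≈y x≤y)))
                                     (g-reg x y)))
            (L.x∧y≤x _ _)
    where open JoinSemilattice joinSemilattice using (x≤y⇒x∨y≈y)

  -- Since `η a ∧ ◇ᵢ a` is below `η (a ∧ b)`, the value `g (a ∧ b)` is a term of the join defining
  -- `extend`.
  cumTrans-≤ : ∀ {i g a b} → CumTrans[ i ] g → ≺[ i ] a b → g (a ∧ b) L.≤ g a
  cumTrans-≤ {i} {a = a} {b} g-ct a≺b =
    L.trans (L.⋁-upper _ (a ∧ b , η-∧-greatest (L.x∧y≤x _ _)
              (L.trans (L.x∧y≤y _ _) (⋀[]-lower (≺[ i ] a) a≺b))))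
            (g-ct a)

  -- Guarding the last two hypotheses by `HasOR i` and `HasCT i` lets one induction serve all four
  -- items; where a rule is absent its guard is empty.
  module _ {i g} (g-open : IsOpenMap g) (g-anti : Antitone g)
           (g-dom : g Dominates ▷)
           (g-reg : HasOR i → Regular g)
           (g-ct : HasCT i → CumTrans[ i ] g) where

    𝒞̄⇒η≤ : ∀ {a b} → 𝒞̄[ i ] a b → η b L.≤ g a
    𝒞̄⇒η≤ (base {a} a𝒞̄b) = L.trans (⋁[]-upper (a 𝒞̄_) a𝒞̄b) (g-dom a)
    𝒞̄⇒η≤ top
      -- The family with join `g ⊤` is nonempty, and any member of it lies above `⊥`.
      with I , (b , b∈I) , _ , g⊤≈⋁I ← proj₂ g-open ⊤
      = L.trans (mono (minimum b))
          (L.trans (⋁[]-upper I b∈I) (L.reflexive (L.Eq.sym g⊤≈⋁I)))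
    𝒞̄⇒η≤ (si bNc a≤b) = L.trans (𝒞̄⇒η≤ bNc) (g-anti a≤b)
    𝒞̄⇒η≤ (wo aNc b≤c) = L.trans (mono b≤c) (𝒞̄⇒η≤ aNc)
    𝒞̄⇒η≤ (and {a} aNb aNc) =
      open-∨-least (proj₂ g-open a) (𝒞̄⇒η≤ aNb) (𝒞̄⇒η≤ aNc)
    𝒞̄⇒η≤ (or hasOR {a} {b} aNc bNc) =
      L.trans (L.∧-greatest (𝒞̄⇒η≤ aNc) (𝒞̄⇒η≤ bNc))
              (L.reflexive (L.Eq.sym (g-reg hasOR a b)))
    𝒞̄⇒η≤ (ct hasCT a≺b abNc) =
      L.trans (𝒞̄⇒η≤ abNc) (cumTrans-≤ {g = g} (g-ct hasCT) a≺b)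

    ▷-least : ∀ a → ▷[ i ] a L.≤ g a
    ▷-least a = L.⋁-least _ _ λ (b , aNb) → 𝒞̄⇒η≤ aNb

proposition6p3 : ∀ {ℓ d e} (A : BoundedLattice ℓ ℓ ℓ)
    (H : ProtoSpAlgebra (BoundedLattice.poset A)) →
    IsDefined (BoundedLattice.poset A) H →
    (Aδ : CanonicalExtension (BoundedLattice.poset A) d e) →
    let open Operators A H Aδ in
    IsSmallest (λ g → IsOpenMap g × Antitone g × g Dominates ▷) ▷[ #1 ]
    × IsSmallest (λ g → IsOpenMap g × Regular g × g Dominates ▷) ▷[ #2 ]
    × IsSmallest (λ g → IsOpenMap g × Antitone g × g Dominates ▷ × CumTrans[ #3 ] g) ▷[ #3 ]
    × IsSmallest (λ g → IsOpenMap g × Regular g × g Dominates ▷ × CumTrans[ #4 ] g) ▷[ #4 ]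
proposition6p3 A H defined Aδ =
    ( (▷-isOpenMap #1 , ▷-antitone #1 , ▷-dominates #1)
    , λ g (g-open , g-anti , g-dom) →
        ▷-least g-open g-anti g-dom (λ ()) (λ ()))
  , ( (▷-isOpenMap #2 , ▷-regular or₂ , ▷-dominates #2)
    , λ g (g-open , g-reg , g-dom) →
        ▷-least g-open (regular⇒antitone g-open g-reg) g-dom (λ _ → g-reg) (λ ()))
  , ( (▷-isOpenMap #3 , ▷-antitone #3 , ▷-dominates #3 , ▷-cumTrans ct₃)
    , λ g (g-open , g-anti , g-dom , g-ct) →
        ▷-least g-open g-anti g-dom (λ ()) (λ _ → g-ct))
  , ( (▷-isOpenMap #4 , ▷-regular or₄ , ▷-dominates #4 , ▷-cumTrans ct₄)
    , λ g (g-open , g-reg , g-dom , g-ct) →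
        ▷-least g-open (regular⇒antitone g-open g-reg) g-dom (λ _ → g-reg) (λ _ → g-ct))
  where open ClosureProperties A H defined Aδ
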